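{- Let $n\ge 1$. (I) Let $R=(r_1,\dots,r_n)$ and $S=(s_1,\dots,s_n)$ be vectors of nonnegative real numbers with $\sum_i r_i=\sum_j s_j$. Then $\mathcal{T}^{4}(R,S)\neq\emptyset$ if and only if (a) $R=S$, and (b) $R$ is palindromic, i.e. $r_i=r_{n+1-i}$ for all $i$. (II) Suppose in addition that $R$ and $S$ have nonnegative integer components. Then $\mathcal{T}^{4}_{\mathbb{Z}}(R,S)\neq\emptyset$ if and only if (a) and (b) hold as well as (c) if $n$ is even then every component of $R$ is even, and if $n$ is odd then $r_{\lceil n/2\rceil}\ge o(R)$, where $o(R)$ is the number of odd components of $R$.
   Context: $\mathcal{T}(R,S)$ is the set of $n\times n$ matrices with nonnegative real entries whose $i$th row sum is $r_i$ and whose $j$th column sum is $s_j$ for all $i,j$. The dihedral group $D_4$ of the square (of order $8$) acts on $n\times n$ matrices by rotations and reflections of the square array; it is generated by the transposition $A\mapsto A^t$ and the reflection $(r_\infty A)_{i,j}=a_{i,\,n+1-j}$. $\mathcal{T}^{4}(R,S)$ is the set of $A\in\mathcal{T}(R,S)$ fixed by every element of $D_4$; $\mathcal{T}^{4}_{\mathbb{Z}}(R,S)$ is the set of those $A\in\mathcal{T}^{4}(R,S)$ all of whose entries are integers. -}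

module Defs where

open import Algebra.Bundles using (CommutativeMonoid)
open import Algebra.Bundles.Raw using (RawMonoid)
open import Data.Fin.Base using (Fin; toℕ)
open import Data.Integer.Base as ℤ using (ℤ)
open import Data.Nat.Base as ℕ using (ℕ; suc; ⌈_/2⌉)
open import Data.Nat.Divisibility using (_∣_; _∣?_)
import Data.Nat.Properties as ℕ
open import Data.Product.Base using (_×_; _,_; ∃-syntax)
open import Data.Rational.Base as ℚ
  using (ℚ; 0ℚ; ½; _<_; _+_; _*_; _-_; ∣_∣; _/_)
import Data.Rational.Properties as ℚ
open import Data.Vec.Base using (count)
open import Data.Vec.Functional as Vector using (Vector; map; reverse; transpose; toVec)
open import Level using (0ℓ)
open import Relation.Binary.PropositionalEquality using (_≡_; sym; trans; cong; subst)
open import Relation.Nullary.Decidable.Core using (¬?)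
open import Relation.Nullary.Negation.Core using (¬_)

-- The real numbers: Cauchy sequences of rationals, considered up to the
-- setoid equality _≈_ below.

IsCauchy : (ℕ → ℚ) → Set
IsCauchy x = ∀ ε → 0ℚ < ε → ∃[ N ] (∀ m n → N ℕ.≤ m → N ℕ.≤ n → ∣ x m - x n ∣ < ε)

record ℝ : Set where
  constructor mkℝ
  field
    seq    : ℕ → ℚ
    cauchy : IsCauchy seq

open ℝ public

infix  4 _≈_ _≤ℝ_ _≋_
infixl 6 _+ℝ_

_≈_ : ℝ → ℝ → Set
x ≈ y = ∀ ε → 0ℚ < ε → ∃[ N ] (∀ n → N ℕ.≤ n → ∣ seq x n - seq y n ∣ < ε)

_≤ℝ_ : ℝ → ℝ → Set
x ≤ℝ y = ∀ ε → 0ℚ < ε → ∃[ N ] (∀ n → N ℕ.≤ n → seq x n < seq y n + ε)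

private
  half-pos : ∀ ε → 0ℚ < ε → 0ℚ < ½ * ε
  half-pos ε 0<ε = ℚ.*-monoʳ-<-pos ½ 0<ε

  halves : ∀ ε → ½ * ε + ½ * ε ≡ ε
  halves ε = trans (sym (ℚ.*-distribʳ-+ ε ½ ½)) (ℚ.*-identityˡ ε)

  sub-interchange : ∀ a b c d → (a + b) - (c + d) ≡ (a - c) + (b - d)
  sub-interchange a b c d =
    trans (cong (a + b +_) (ℚ.neg-distrib-+ c d)) (interchange a b (ℚ.- c) (ℚ.- d))
    where open import Algebra.Properties.CommutativeSemigroup
                 (CommutativeMonoid.commutativeSemigroup ℚ.+-0-commutativeMonoid)
                 using (interchange)

  +-cauchy : ∀ x y → IsCauchy x → IsCauchy y → IsCauchy (λ n → x n + y n)
  +-cauchy x y cx cy ε 0<ε =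
    let (M , p) = cx (½ * ε) (half-pos ε 0<ε)
        (N , q) = cy (½ * ε) (half-pos ε 0<ε)
    in M ℕ.⊔ N , λ m n m≥ n≥ → begin-strict
      ∣ (x m + y m) - (x n + y n) ∣
        ≡⟨ cong ∣_∣ (sub-interchange (x m) (y m) (x n) (y n)) ⟩
      ∣ (x m - x n) + (y m - y n) ∣
        ≤⟨ ℚ.∣p+q∣≤∣p∣+∣q∣ (x m - x n) (y m - y n) ⟩
      ∣ x m - x n ∣ + ∣ y m - y n ∣
        <⟨ ℚ.+-mono-<
             (p m n (ℕ.m⊔n≤o⇒m≤o M N m≥) (ℕ.m⊔n≤o⇒m≤o M N n≥))
             (q m n (ℕ.m⊔n≤o⇒n≤o M N m≥) (ℕ.m⊔n≤o⇒n≤o M N n≥)) ⟩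
      ½ * ε + ½ * ε
        ≡⟨ halves ε ⟩
      ε ∎
    where open ℚ.≤-Reasoning

  const-cauchy : ∀ q → IsCauchy (λ _ → q)
  const-cauchy q ε 0<ε = 0 , λ _ _ _ _ → subst (λ d → ∣ d ∣ < ε) (sym (ℚ.+-inverseʳ q)) 0<ε

_+ℝ_ : ℝ → ℝ → ℝ
x +ℝ y = mkℝ (λ n → seq x n + seq y n) (+-cauchy (seq x) (seq y) (cauchy x) (cauchy y))

fromℚ : ℚ → ℝ
fromℚ q = mkℝ (λ _ → q) (const-cauchy q)

fromℤ : ℤ → ℝ
fromℤ z = fromℚ (z / 1)

fromℕ : ℕ → ℝ
fromℕ k = fromℤ (ℤ.+ k)

0ℝ : ℝ
0ℝ = fromℚ 0ℚ

+ℝ-rawMonoid : RawMonoid 0ℓ 0ℓ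
+ℝ-rawMonoid = record { Carrier = ℝ ; _≈_ = _≈_ ; _∙_ = _+ℝ_ ; ε = 0ℝ }

open import Algebra.Definitions.RawMonoid +ℝ-rawMonoid public using (sum)

_≋_ : ∀ {n} → Vector ℝ n → Vector ℝ n → Set
R ≋ S = ∀ i → R i ≈ S i

Nonnegative : ∀ {n} → Vector ℝ n → Set
Nonnegative R = ∀ i → 0ℝ ≤ℝ R i

-- With indices 0, …, n-1, reverse sends i to n-1-i.
Palindromic : ∀ {n} → Vector ℝ n → Set
Palindromic R = R ≋ reverse R

Matrix : ℕ → Set
Matrix n = Vector (Vector ℝ n) n

reflect : ∀ {n} → Matrix n → Matrix n
reflect = map reverse

rotate : ∀ {n} → Matrix n → Matrix n
rotate A = reflect (transpose A)

-- The eight symmetries of the square.  Reflections are named by their axis;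
-- rotations are clockwise.
data D₄ : Set where
  rot0 rot90 rot180 rot270                  : D₄
  vertical horizontal diagonal antidiagonal : D₄

act : ∀ {n} → D₄ → Matrix n → Matrix n
act rot0         A = A
act rot90        A = rotate A
act rot180       A = rotate (rotate A)
act rot270       A = rotate (rotate (rotate A))
act vertical     A = reflect A
act horizontal   A = transpose (reflect (transpose A))
act diagonal     A = transpose A
act antidiagonal A = reflect (transpose (reflect A))

record 𝒯 {n} (R S : Vector ℝ n) (A : Matrix n) : Set where
  field
    nonnegative : ∀ i j → 0ℝ ≤ℝ A i j
    rowSums     : ∀ i → sum (A i) ≈ R i
    columnSums  : ∀ j → sum (transpose A j) ≈ S j

record 𝒯⁴ {n} (R S : Vector ℝ n) (A : Matrix n) : Set where
  field
    member : 𝒯 R S A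
    fixed  : ∀ g i → act g A i ≋ A i

record 𝒯⁴ℤ {n} (R S : Vector ℝ n) (A : Matrix n) : Set where
  field
    member   : 𝒯⁴ R S A
    integral : ∀ i j → ∃[ z ] A i j ≈ fromℤ z

oddCount : ∀ {n} → Vector ℕ n → ℕ
oddCount r = count (λ k → ¬? (2 ∣? k)) (toVec r)

-- The index i with toℕ i + 1 = ⌈n/2⌉ is the middle one (unique for n ≥ 1).
ParityCondition : ∀ {n} → Vector ℕ n → Set
ParityCondition {n} r =
    (2 ∣ n → ∀ i → 2 ∣ r i)
  × (¬ 2 ∣ n → ∀ (i : Fin n) → suc (toℕ i) ≡ ⌈ n /2⌉ → oddCount r ℕ.≤ r i)

{-# OPTIONS --safe #-}

-- A matrix fixed by D₄ is symmetric with palindromic rows, which forces R = S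
-- palindromic.  Conversely, putting rᵢ/2 at (i , i) and at (i , n+1-i) works.
-- Over the integers, a palindromic row has an even sum when n is even, and a sum
-- congruent to its middle entry modulo 2 when n is odd; then each odd rᵢ costs the
-- middle column, whose sum is r_m, at least 1.  Conversely, for n odd, the parities
-- of the non-middle rᵢ go in the middle row and column, the halves on the two
-- diagonals, and the centre absorbs what is left of r_m.

module Submission where

open import Algebra.Bundles using (CommutativeMonoid)
open import Data.Bool.Base using (if_then_else_)
open import Data.Fin.Base using (Fin; zero; suc; toℕ; fromℕ<; opposite)
open import Data.Fin.Permutation using () renaming (reverse to reversal)
open import Data.Fin.Properties
  using (_≟_; toℕ<n; toℕ-fromℕ<; toℕ-injective; opposite-prop; opposite-involutive)
open import Data.Integer.Base as ℤ using (+_; -[1+_])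
import Data.Integer.Properties as ℤ
open import Data.Nat.Base as ℕ using (ℕ; zero; suc; _≥_; _/_; _%_; z≤n; s≤s; ⌈_/2⌉)
open import Data.Nat.Coprimality using (1-coprimeTo) renaming (sym to coprime-sym)
open import Data.Nat.Divisibility
  using (_∣_; divides; _∣?_; ∣m+n∣m⇒∣n; m%n≡0⇒n∣m; n∣m⇒m%n≡0; ∣1⇒≡1)
open import Data.Nat.DivMod using (m≡m%n+[m/n]*n; m%n<n; m%n≤m; [m+kn]%n≡m%n)
import Data.Nat.Properties as ℕ
open import Data.Product.Base using (_×_; _,_; ∃; ∃-syntax; proj₁; proj₂)
open import Data.Rational.Base as ℚ using (ℚ; mkℚ; 0ℚ; ½; ∣_∣)
import Data.Rational.Properties as ℚ
open import Data.Rational.Solver using (module +-*-Solver)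
open import Data.Sum.Base using (inj₁; inj₂)
open import Data.Vec.Functional using (Vector; map)
open import Defs
open import Function.Base using (_∘_; id)
open import Function.Bundles using (_⇔_; mk⇔)
open import Level using (0ℓ)
open import Relation.Binary.PropositionalEquality
  using (_≡_; refl; sym; trans; cong; cong₂; subst; subst₂; module ≡-Reasoning)
open import Relation.Binary.Definitions using (tri<; tri≈; tri>)
open import Relation.Nullary.Decidable using (does; yes; no; ¬?; dec-true; dec-false)
open import Relation.Nullary.Negation.Core using (¬_; contradiction)

-- Symmetric matrices with palindromic rows over a commutative monoid

module Pattern {c ℓ} (M : CommutativeMonoid c ℓ) where
  open CommutativeMonoid M renaming (_≈_ to _∼_; refl to ∼-refl; sym to ∼-sym; trans to ∼-trans)
  open import Algebra.Properties.CommutativeMonoid.Sum M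
    using (sum-replicate-zero; ∑-distrib-+) renaming (sum to Σ⟨_⟩) public

  private variable
    n : ℕ

  single : Fin n → Carrier → Vector Carrier n
  single i x j = if does (i ≟ j) then x else ε

  sum-single : (i : Fin n) (x : Carrier) → Σ⟨ single i x ⟩ ∼ x
  sum-single {suc n} zero    x = ∼-trans (∙-congˡ (sum-replicate-zero n)) (identityʳ x)
  sum-single {suc n} (suc i) x = ∼-trans (identityˡ _) (sum-single i x)

  -- The values are compared only under `i ≡ j`, so a caller may use the index equation itself, as
  -- `cross-symmetric` does to trade `h i` for `h j`.
  single-cong : {i j k l : Fin n} {x y : Carrier} →
                (i ≡ j → k ≡ l) → (k ≡ l → i ≡ j) → (i ≡ j → x ∼ y) →
                single i x j ∼ single k y l
  single-cong {i = i} {j} {k} {l} f g x∼y with i ≟ j | k ≟ l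
  ... | yes p | yes q = x∼y p
  ... | yes p | no ¬q = contradiction (f p) ¬q
  ... | no ¬p | yes q = contradiction (g q) ¬p
  ... | no ¬p | no ¬q = ∼-refl

  -- The test `m ≟ i` does not depend on `j`, so it can be moved out of the sum.
  sum-single-column : (m i : Fin n) (f : Vector Carrier n) →
                      Σ⟨ (λ j → single m (f j) i) ⟩ ∼ single m Σ⟨ f ⟩ i
  sum-single-column {n} m i f with m ≟ i
  ... | yes _ = ∼-refl
  ... | no  _ = sum-replicate-zero n

  Symmetric Reflective : (Fin n → Fin n → Carrier) → Set _
  Symmetric  A = ∀ i j → A i j ∼ A j i
  Reflective A = ∀ i j → A i (opposite j) ∼ A i j

  opposite-≡ : {i j : Fin n} → opposite i ≡ j → i ≡ opposite j
  opposite-≡ {i = i} p = trans (sym (opposite-involutive i)) (cong opposite p)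

  opposite-≡˘ : {i j : Fin n} → i ≡ opposite j → opposite i ≡ j
  opposite-≡˘ {j = j} p = trans (cong opposite p) (opposite-involutive j)

  -- The two diagonals of the square. Since they are added, both values accumulate on a cell where
  -- the diagonals meet, and the row sum needs no separate case for the centre.
  cross : Vector Carrier n → Fin n → Fin n → Carrier
  cross h i j = single i (h i) j ∙ single (opposite i) (h i) j

  module _ (h : Vector Carrier n) where

    cross-row : ∀ i → Σ⟨ cross h i ⟩ ∼ h i ∙ h i
    cross-row i = ∼-trans (∑-distrib-+ (single i (h i)) (single (opposite i) (h i)))
                          (∙-cong (sum-single i (h i)) (sum-single (opposite i) (h i)))

    -- Reflection exchanges the two diagonals, so the two summands trade places and commutativity
    -- finishes.
    cross-reflective : Reflective (cross h)
    cross-reflective i j = ∼-trans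
      (∙-cong (single-cong {i = i} {opposite j} {opposite i} {j} opposite-≡˘ opposite-≡ (λ _ → ∼-refl))
              (single-cong {i = opposite i} {opposite j} {i} {j}
                (λ p → trans (opposite-≡ p) (opposite-involutive j)) (cong opposite) (λ _ → ∼-refl)))
      (comm _ _)

    -- Transposition preserves each diagonal. On the antidiagonal it exchanges rows `i` and
    -- `opposite i`, which is where the palindromic hypothesis enters.
    cross-symmetric : (∀ i → h i ∼ h (opposite i)) → Symmetric (cross h)
    cross-symmetric pal i j = ∙-cong
      (single-cong sym sym (λ p → reflexive (cong h p)))
      (single-cong (sym ∘ opposite-≡) (sym ∘ opposite-≡)
                   (λ p → ∼-trans (pal i) (reflexive (cong h p))))

  -- The vector `p` is laid along column `m` and again along row `m`, with `c` added where they
  -- cross. The centre receives `p m` twice; in `oddMatrix` this entry of `p` is zero.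
  hub : Fin n → Vector Carrier n → Carrier → Fin n → Fin n → Carrier
  hub m p c i j = single m (p i) j ∙ single m (p j ∙ single m c j) i

  module _ (m : Fin n) (p : Vector Carrier n) (c : Carrier) where

    -- Each row meets column `m` once, in `p i`; only row `m` also collects the whole of `p`
    -- together with `c`.
    hub-row : ∀ i → Σ⟨ hub m p c i ⟩ ∼ p i ∙ single m (Σ⟨ p ⟩ ∙ c) i
    hub-row i = ∼-trans
      (∑-distrib-+ (single m (p i)) (λ j → single m (p j ∙ single m c j) i))
      (∙-cong (sum-single m (p i)) (∼-trans (sum-single-column m i _)
        (single-cong {i = m} {i} {m} {i} id id
          (λ _ → ∼-trans (∑-distrib-+ p (single m c)) (∙-congˡ (sum-single m c))))))

    hub-symmetric : Symmetric (hub m p c)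
    hub-symmetric i j with m ≟ i | m ≟ j
    ... | yes refl | yes refl = ∼-refl
    ... | yes _    | no _     = ∼-trans (identityˡ _) (∼-trans (identityʳ _) (∼-sym (identityʳ _)))
    ... | no _     | yes _    = ∼-trans (identityʳ _) (∼-sym (∼-trans (identityˡ _) (identityʳ _)))
    ... | no _     | no _     = ∼-refl

    -- Column `m` is mapped to itself because `m` is fixed; row `m` is reversed, so `p` has to be
    -- palindromic.
    hub-reflective : opposite m ≡ m → (∀ i → p i ∼ p (opposite i)) → Reflective (hub m p c)
    hub-reflective fix pal i j = ∙-cong (at-centre (p i))
      (single-cong {i = m} {i} {m} {i} id id (λ _ → ∙-cong (∼-sym (pal j)) (at-centre c)))
      where
      at-centre : ∀ x → single m x (opposite j) ∼ single m x j
      at-centre x = single-cong (λ q → trans (sym fix) (opposite-≡˘ q))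
                                (λ q → trans (sym fix) (cong opposite q)) (λ _ → ∼-refl)

-- Parity of palindromic sums of natural numbers

open Pattern ℕ.+-0-commutativeMonoid
  using (single; sum-single; single-cong; cross; hub) renaming (Σ⟨_⟩ to sumℕ)
module ℕP = Pattern ℕ.+-0-commutativeMonoid
open import Algebra.Properties.CommutativeMonoid.Sum ℕ.+-0-commutativeMonoid
  using (∑-distrib-+; sum-permute; sum-cong-≗; sum-replicate-zero)

sumℕ-mono-≤ : ∀ {n} {f g : Vector ℕ n} → (∀ i → f i ℕ.≤ g i) → sumℕ f ℕ.≤ sumℕ g
sumℕ-mono-≤ {zero}  f≤g = z≤n
sumℕ-mono-≤ {suc n} f≤g = ℕ.+-mono-≤ (f≤g zero) (sumℕ-mono-≤ (f≤g ∘ suc))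

double : ∀ k → k ℕ.+ k ≡ k ℕ.* 2
double k = trans (cong (k ℕ.+_) (sym (ℕ.+-identityʳ k))) (ℕ.*-comm 2 k)

double-injective : ∀ {k l} → k ℕ.+ k ≡ l ℕ.+ l → k ≡ l
double-injective {k} {l} p = trans (ℕ.n≡⌊n+n/2⌋ k) (trans (cong ℕ.⌊_/2⌋ p) (sym (ℕ.n≡⌊n+n/2⌋ l)))

halves+parity : ∀ k → (k / 2 ℕ.+ k / 2) ℕ.+ k % 2 ≡ k
halves+parity k = trans (ℕ.+-comm _ (k % 2))
  (trans (cong (k % 2 ℕ.+_) (double (k / 2))) (sym (m≡m%n+[m/n]*n k 2)))

halves : ∀ {k} → 2 ∣ k → k / 2 ℕ.+ k / 2 ≡ k
halves {k} 2∣k = trans (sym (ℕ.+-identityʳ _))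
  (trans (cong (k / 2 ℕ.+ k / 2 ℕ.+_) (sym (n∣m⇒m%n≡0 k 2 2∣k))) (halves+parity k))

odd-% : ∀ k → ¬ 2 ∣ k → k % 2 ≡ 1
odd-% k odd with k % 2 in eq | m%n<n k 2
... | 0           | _                = contradiction (m%n≡0⇒n∣m k 2 eq) odd
... | 1           | _                = refl
... | suc (suc _) | s≤s (s≤s ())

odd-form : ∀ {k} → ¬ 2 ∣ k → k ≡ suc (k / 2 ℕ.+ k / 2)
odd-form {k} odd = trans (sym (halves+parity k))
  (trans (cong (k / 2 ℕ.+ k / 2 ℕ.+_) (odd-% k odd)) (ℕ.+-comm _ 1))

-- The value of `opposite j` is `n - 1 - j`. Hence a fixed point excludes even `n`, and for odd `n`
-- it is unique.
fixed⇒middle : ∀ {n} (j : Fin n) → opposite j ≡ j → n ≡ suc (toℕ j ℕ.+ toℕ j)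
fixed⇒middle {n} j p = begin
  n                                   ≡⟨ ℕ.m∸n+n≡m (toℕ<n j) ⟨
  (n ℕ.∸ suc (toℕ j)) ℕ.+ suc (toℕ j) ≡⟨ cong (ℕ._+ suc (toℕ j)) (opposite-prop j) ⟨
  toℕ (opposite j) ℕ.+ suc (toℕ j)    ≡⟨ cong (λ i → toℕ i ℕ.+ suc (toℕ j)) p ⟩
  toℕ j ℕ.+ suc (toℕ j)               ≡⟨ ℕ.+-suc (toℕ j) (toℕ j) ⟩
  suc (toℕ j ℕ.+ toℕ j)               ∎
  where open ≡-Reasoning

middle⇒fixed : ∀ {n} (j : Fin n) → n ≡ suc (toℕ j ℕ.+ toℕ j) → opposite j ≡ j
middle⇒fixed {n} j p = toℕ-injective
  (trans (opposite-prop j) (trans (cong (ℕ._∸ suc (toℕ j)) p) (ℕ.m+n∸n≡m (toℕ j) (toℕ j))))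

⌈/2⌉-middle : ∀ k → ⌈ suc (k ℕ.+ k) /2⌉ ≡ suc k
⌈/2⌉-middle k = cong suc (sym (ℕ.n≡⌊n+n/2⌋ k))

-- `ParityCondition` counts the middle from 1. With `n = 2k + 1` the ceiling is `k + 1`, so the
-- zero-based index is `k`.
ceil⇒middle : ∀ {n} → ¬ 2 ∣ n → (m : Fin n) → suc (toℕ m) ≡ ⌈ n /2⌉ → n ≡ suc (toℕ m ℕ.+ toℕ m)
ceil⇒middle {n} odd m p = subst (λ k → n ≡ suc (k ℕ.+ k)) (sym toℕm≡) (odd-form odd)
  where
  toℕm≡ : toℕ m ≡ n / 2
  toℕm≡ = ℕ.suc-injective (trans p (trans (cong ⌈_/2⌉ (odd-form odd)) (⌈/2⌉-middle (n / 2))))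

middle : ∀ {n} → ¬ 2 ∣ n → ∃[ m ] n ≡ suc (toℕ {n} m ℕ.+ toℕ m)
middle {n} odd = fromℕ< k<n , subst (λ k → n ≡ suc (k ℕ.+ k)) (sym (toℕ-fromℕ< k<n)) (odd-form odd)
  where
  k<n : n / 2 ℕ.< n
  k<n = subst (n / 2 ℕ.<_) (sym (odd-form odd)) (s≤s (ℕ.m≤m+n (n / 2) (n / 2)))

module _ {n} (f : Vector ℕ n) (pal : ∀ i → f (opposite i) ≡ f i) where

  private
    lower : Vector ℕ n
    lower j = if does (toℕ j ℕ.<? toℕ (opposite j)) then f j else 0

    onAxis : Vector ℕ n
    onAxis j = single (opposite j) (f j) j

    -- An index lies before its mirror image, after it, or on the axis; accordingly one of the three
    -- terms is `f j` and the other two are zero. Palindromicity serves the second case, where the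
    -- term found is `f (opposite j)`.
    split : ∀ j → f j ≡ (lower j ℕ.+ lower (opposite j)) ℕ.+ onAxis j
    split j rewrite opposite-involutive j | pal j
      with ℕ.<-cmp (toℕ j) (toℕ (opposite j)) | opposite j ≟ j
    ... | tri< p _ _ | yes r = contradiction (sym (cong toℕ r)) (ℕ.<⇒≢ p)
    ... | tri> _ _ q | yes r = contradiction (cong toℕ r) (ℕ.<⇒≢ q)
    ... | tri≈ _ r _ | no ¬r = contradiction (toℕ-injective (sym r)) ¬r
    ... | tri< p _ ¬q | no _
      rewrite dec-true (toℕ j ℕ.<? toℕ (opposite j)) p
            | dec-false (toℕ (opposite j) ℕ.<? toℕ j) ¬q
      = sym (trans (ℕ.+-identityʳ _) (ℕ.+-identityʳ _))
    ... | tri> ¬p _ q | no _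
      rewrite dec-false (toℕ j ℕ.<? toℕ (opposite j)) ¬p
            | dec-true (toℕ (opposite j) ℕ.<? toℕ j) q
      = sym (ℕ.+-identityʳ _)
    ... | tri≈ ¬p _ ¬q | yes _
      rewrite dec-false (toℕ j ℕ.<? toℕ (opposite j)) ¬p
            | dec-false (toℕ (opposite j) ℕ.<? toℕ j) ¬q
      = refl

    -- Reindexing by the reversal identifies the sums over the two sides, so modulo 2 only the axis
    -- counts.
    sum-split : sumℕ f ≡ (sumℕ lower ℕ.+ sumℕ lower) ℕ.+ sumℕ onAxis
    sum-split = begin
      sumℕ f
        ≡⟨ sum-cong-≗ split ⟩
      sumℕ (λ j → (lower j ℕ.+ lower (opposite j)) ℕ.+ onAxis j)
        ≡⟨ ∑-distrib-+ (λ j → lower j ℕ.+ lower (opposite j)) onAxis ⟩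
      sumℕ (λ j → lower j ℕ.+ lower (opposite j)) ℕ.+ sumℕ onAxis
        ≡⟨ cong (ℕ._+ sumℕ onAxis) (∑-distrib-+ lower (lower ∘ opposite)) ⟩
      (sumℕ lower ℕ.+ sumℕ (lower ∘ opposite)) ℕ.+ sumℕ onAxis
        ≡⟨ cong (λ s → (sumℕ lower ℕ.+ s) ℕ.+ sumℕ onAxis) (sum-permute lower reversal) ⟨
      (sumℕ lower ℕ.+ sumℕ lower) ℕ.+ sumℕ onAxis ∎
      where open ≡-Reasoning

  palindromic-sum-even : 2 ∣ n → 2 ∣ sumℕ f
  palindromic-sum-even (divides k n≡k*2) = divides (sumℕ lower)
    (trans sum-split (trans (cong (sumℕ lower ℕ.+ sumℕ lower ℕ.+_) sum-onAxis)
      (trans (ℕ.+-identityʳ _) (double (sumℕ lower)))))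
    where
    noFixed : ∀ j → ¬ opposite j ≡ j
    -- A fixed point would give `n = 2j + 1`; as 2 divides both `n` and `2j`, it would divide 1.
    noFixed j p = contradiction (∣1⇒≡1 (∣m+n∣m⇒∣n
        (divides k (trans (ℕ.+-comm _ 1) (trans (sym (fixed⇒middle j p)) n≡k*2)))
        (divides (toℕ j) (double (toℕ j)))))
      (λ ())

    onAxis≡0 : ∀ j → onAxis j ≡ 0
    onAxis≡0 j with opposite j ≟ j
    ... | yes p = contradiction p (noFixed j)
    ... | no _  = refl

    sum-onAxis : sumℕ onAxis ≡ 0
    sum-onAxis = trans (sum-cong-≗ onAxis≡0) (sum-replicate-zero n)

  -- For odd `n` the axis consists of the single index `m`, so `onAxis` sums to `f m`.
  palindromic-sum-parity : (m : Fin n) → n ≡ suc (toℕ m ℕ.+ toℕ m) → sumℕ f % 2 ≡ f m % 2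
  palindromic-sum-parity m mid = begin
    sumℕ f % 2                                         ≡⟨ cong (_% 2) sum-split ⟩
    (sumℕ lower ℕ.+ sumℕ lower ℕ.+ sumℕ onAxis) % 2    ≡⟨ cong (_% 2) (cong₂ ℕ._+_ (double (sumℕ lower)) sum-onAxis) ⟩
    (sumℕ lower ℕ.* 2 ℕ.+ f m) % 2                     ≡⟨ cong (_% 2) (ℕ.+-comm _ (f m)) ⟩
    (f m ℕ.+ sumℕ lower ℕ.* 2) % 2                     ≡⟨ [m+kn]%n≡m%n (f m) (sumℕ lower) 2 ⟩
    f m % 2                                            ∎
    where
    open ≡-Reasoning

    unique : ∀ {j} → opposite j ≡ j → m ≡ j
    unique {j} p = toℕ-injective (double-injective (ℕ.suc-injective (trans (sym mid) (fixed⇒middle j p))))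

    onAxis≡single : ∀ j → onAxis j ≡ single m (f m) j
    onAxis≡single j = single-cong unique
      (λ { refl → middle⇒fixed m mid }) (λ p → cong f (sym (unique p)))

    sum-onAxis : sumℕ onAxis ≡ f m
    sum-onAxis = trans (sum-cong-≗ onAxis≡single) (sum-single m (f m))

-- As a sum of remainders, the count can be compared term by term with the entries of a matrix row.
oddCount-sum : ∀ {n} (r : Vector ℕ n) → oddCount r ≡ sumℕ (λ i → r i % 2)
oddCount-sum {zero}  r = refl
oddCount-sum {suc n} r = trans (indicator (r zero) _) (cong (r zero % 2 ℕ.+_) (oddCount-sum (r ∘ suc)))
  where
  indicator : ∀ k x → (if does (¬? (2 ∣? k)) then suc else id) x ≡ k % 2 ℕ.+ x
  -- The decision `2 ∣? k` computes through `k % 2`, so fixing the remainder evaluates both sides.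
  indicator k x with k % 2 | m%n<n k 2
  ... | 0           | _            = refl
  ... | 1           | _            = refl
  ... | suc (suc _) | s≤s (s≤s ())

-- The additive monoid of real numbers

half-pos : ∀ {ε} → 0ℚ ℚ.< ε → 0ℚ ℚ.< ½ ℚ.* ε
half-pos = ℚ.*-monoʳ-<-pos ½

½+½ : ∀ q → ½ ℚ.* q ℚ.+ ½ ℚ.* q ≡ q
½+½ q = trans (sym (ℚ.*-distribʳ-+ q ½ ½)) (ℚ.*-identityˡ q)

∣+∣< : ∀ p q {ε} → ∣ p ∣ ℚ.< ½ ℚ.* ε → ∣ q ∣ ℚ.< ½ ℚ.* ε → ∣ p ℚ.+ q ∣ ℚ.< ε
∣+∣< p q {ε} p< q< = subst (∣ p ℚ.+ q ∣ ℚ.<_) (½+½ ε)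
  (ℚ.≤-<-trans (ℚ.∣p+q∣≤∣p∣+∣q∣ p q) (ℚ.+-mono-< p< q<))

∣-∣-swap : ∀ p q → ∣ p ℚ.- q ∣ ≡ ∣ q ℚ.- p ∣
∣-∣-swap p q = trans (sym (ℚ.∣-p∣≡∣p∣ (p ℚ.- q)))
  (cong ∣_∣ (solve 2 (λ p q → :- (p :- q) := q :- p) refl p q))
  where open +-*-Solver

-- Through this, associativity, identity and commutativity of `_+ℝ_` are inherited termwise from
-- `ℚ`.
seq-≡⇒≈ : ∀ {x y} → (∀ n → seq x n ≡ seq y n) → x ≈ y
seq-≡⇒≈ {x} {y} x≡y ε 0<ε = 0 , λ n _ →
  subst (ℚ._< ε) (sym (cong ∣_∣ (trans (cong (ℚ._- seq y n) (x≡y n)) (ℚ.+-inverseʳ (seq y n))))) 0<ε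

≈-refl : ∀ x → x ≈ x
≈-refl x = seq-≡⇒≈ {x} {x} (λ _ → refl)

≈-sym : ∀ {x y} → x ≈ y → y ≈ x
≈-sym {x} {y} x≈y ε 0<ε = let (N , close) = x≈y ε 0<ε in
  N , λ n n≥ → subst (ℚ._< ε) (∣-∣-swap (seq x n) (seq y n)) (close n n≥)

≈-trans : ∀ {x y z} → x ≈ y → y ≈ z → x ≈ z
≈-trans {x} {y} {z} x≈y y≈z ε 0<ε =
  let (M , p) = x≈y _ (half-pos 0<ε) ; (N , q) = y≈z _ (half-pos 0<ε) in
  M ℕ.⊔ N , λ n n≥ →
    subst (λ d → ∣ d ∣ ℚ.< ε)
      (solve 3 (λ a b c → (a :- b) :+ (b :- c) := a :- c) refl (seq x n) (seq y n) (seq z n))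
      (∣+∣< _ _ (p n (ℕ.m⊔n≤o⇒m≤o M N n≥)) (q n (ℕ.m⊔n≤o⇒n≤o M N n≥)))
  where open +-*-Solver

+ℝ-cong : ∀ {x y u v} → x ≈ y → u ≈ v → x +ℝ u ≈ y +ℝ v
+ℝ-cong {x} {y} {u} {v} x≈y u≈v ε 0<ε =
  let (M , p) = x≈y _ (half-pos 0<ε) ; (N , q) = u≈v _ (half-pos 0<ε) in
  M ℕ.⊔ N , λ n n≥ →
    subst (λ d → ∣ d ∣ ℚ.< ε)
      (solve 4 (λ a b c d → (a :- b) :+ (c :- d) := (a :+ c) :- (b :+ d)) refl
        (seq x n) (seq y n) (seq u n) (seq v n))
      (∣+∣< _ _ (p n (ℕ.m⊔n≤o⇒m≤o M N n≥)) (q n (ℕ.m⊔n≤o⇒n≤o M N n≥)))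
  where open +-*-Solver

+ℝ-0-commutativeMonoid : CommutativeMonoid 0ℓ 0ℓ
+ℝ-0-commutativeMonoid = record
  { Carrier = ℝ ; _≈_ = _≈_ ; _∙_ = _+ℝ_ ; ε = 0ℝ
  ; isCommutativeMonoid = record
    { isMonoid = record
      { isSemigroup = record
        { isMagma = record
          { isEquivalence = record
            { refl  = λ {x} → ≈-refl x
            ; sym   = λ {x} {y} → ≈-sym {x} {y}
            ; trans = λ {x} {y} {z} → ≈-trans {x} {y} {z}
            }
          ; ∙-cong = λ {x} {y} {u} {v} → +ℝ-cong {x} {y} {u} {v}
          }
        ; assoc = λ x y z → seq-≡⇒≈ {(x +ℝ y) +ℝ z} {x +ℝ (y +ℝ z)}
                              (λ n → ℚ.+-assoc (seq x n) (seq y n) (seq z n))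
        }
      ; identity = (λ x → seq-≡⇒≈ {0ℝ +ℝ x} {x} (λ n → ℚ.+-identityˡ (seq x n)))
                 , (λ x → seq-≡⇒≈ {x +ℝ 0ℝ} {x} (λ n → ℚ.+-identityʳ (seq x n)))
      }
    ; comm = λ x y → seq-≡⇒≈ {x +ℝ y} {y +ℝ x} (λ n → ℚ.+-comm (seq x n) (seq y n))
    }
  }

module ℝP = Pattern +ℝ-0-commutativeMonoid
open import Algebra.Properties.CommutativeMonoid.Sum +ℝ-0-commutativeMonoid
  using () renaming (sum-cong-≋ to sumℝ-cong)
import Relation.Binary.Reasoning.Setoid as SetoidReasoning
module ≈-Reasoning = SetoidReasoning (CommutativeMonoid.setoid +ℝ-0-commutativeMonoid)

-- Nonnegativity and halving of real numbers

p≤∣p∣ : ∀ p → p ℚ.≤ ∣ p ∣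
p≤∣p∣ p with ℚ.≤-total 0ℚ p
... | inj₁ 0≤p = ℚ.≤-reflexive (sym (ℚ.0≤p⇒∣p∣≡p 0≤p))
... | inj₂ p≤0 = ℚ.≤-trans p≤0 (ℚ.0≤∣p∣ p)

-- Eventually `0 < x + ε/2` and `0 < ε/2 - (x - y)`; these add up to `0 < y + ε`.
0≤-resp-≈ : ∀ {x y} → x ≈ y → 0ℝ ≤ℝ x → 0ℝ ≤ℝ y
0≤-resp-≈ {x} {y} x≈y 0≤x ε 0<ε =
  let (M , p) = x≈y _ (half-pos 0<ε) ; (N , q) = 0≤x _ (half-pos 0<ε) in
  M ℕ.⊔ N , λ n n≥ →
    subst₂ ℚ._<_ (ℚ.+-identityˡ 0ℚ) (regroup (seq x n) (seq y n))
      (ℚ.+-mono-< (q n (ℕ.m⊔n≤o⇒n≤o M N n≥))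
                  (subst (ℚ._< ½ ℚ.* ε ℚ.- (seq x n ℚ.- seq y n)) (ℚ.+-inverseʳ (seq x n ℚ.- seq y n))
                    (ℚ.+-monoˡ-< (ℚ.- (seq x n ℚ.- seq y n))
                      (ℚ.≤-<-trans (p≤∣p∣ _) (p n (ℕ.m⊔n≤o⇒m≤o M N n≥))))))
  where
  open +-*-Solver
  regroup : ∀ a b → (a ℚ.+ ½ ℚ.* ε) ℚ.+ (½ ℚ.* ε ℚ.- (a ℚ.- b)) ≡ b ℚ.+ ε
  regroup a b = trans
    (solve 3 (λ a b e → (a :+ e) :+ (e :- (a :- b)) := b :+ (e :+ e)) refl a b (½ ℚ.* ε))
    (cong (b ℚ.+_) (½+½ ε))

0≤-+ : ∀ {x y} → 0ℝ ≤ℝ x → 0ℝ ≤ℝ y → 0ℝ ≤ℝ x +ℝ y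
0≤-+ {x} {y} 0≤x 0≤y ε 0<ε =
  let (M , p) = 0≤x _ (half-pos 0<ε) ; (N , q) = 0≤y _ (half-pos 0<ε) in
  M ℕ.⊔ N , λ n n≥ →
    subst₂ ℚ._<_ (ℚ.+-identityˡ 0ℚ) (regroup (seq x n) (seq y n))
      (ℚ.+-mono-< (p n (ℕ.m⊔n≤o⇒m≤o M N n≥)) (q n (ℕ.m⊔n≤o⇒n≤o M N n≥)))
  where
  open +-*-Solver
  regroup : ∀ a b → (a ℚ.+ ½ ℚ.* ε) ℚ.+ (b ℚ.+ ½ ℚ.* ε) ≡ (a ℚ.+ b) ℚ.+ ε
  regroup a b = trans
    (solve 3 (λ a b e → (a :+ e) :+ (b :+ e) := (a :+ b) :+ (e :+ e)) refl a b (½ ℚ.* ε))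
    (cong (a ℚ.+ b ℚ.+_) (½+½ ε))

½*-< : ∀ {ε} → 0ℚ ℚ.< ε → ½ ℚ.* ε ℚ.< ε
½*-< {ε} 0<ε = subst₂ ℚ._<_ (ℚ.+-identityʳ _) (½+½ ε) (ℚ.+-monoʳ-< (½ ℚ.* ε) (half-pos 0<ε))

∣½*-½*∣ : ∀ p q → ∣ ½ ℚ.* p ℚ.- ½ ℚ.* q ∣ ≡ ½ ℚ.* ∣ p ℚ.- q ∣
∣½*-½*∣ p q = trans
  (cong ∣_∣ (solve 3 (λ h p q → h :* p :- h :* q := h :* (p :- q)) refl ½ p q))
  (ℚ.∣p*q∣≡∣p∣*∣q∣ ½ (p ℚ.- q))
  where open +-*-Solver

∣½*-½*∣< : ∀ p q {ε} → 0ℚ ℚ.< ε → ∣ p ℚ.- q ∣ ℚ.< ε → ∣ ½ ℚ.* p ℚ.- ½ ℚ.* q ∣ ℚ.< ε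
∣½*-½*∣< p q {ε} 0<ε close = subst (ℚ._< ε) (sym (∣½*-½*∣ p q))
  (ℚ.<-trans (ℚ.*-monoʳ-<-pos ½ close) (½*-< 0<ε))

-- Halving contracts distances, so the index that works for `x` at `ε` works here as well.
half : ℝ → ℝ
half x = mkℝ (λ n → ½ ℚ.* seq x n) λ ε 0<ε → let (N , p) = cauchy x ε 0<ε in
  N , λ m n m≥ n≥ → ∣½*-½*∣< (seq x m) (seq x n) 0<ε (p m n m≥ n≥)

half-cong : ∀ {x y} → x ≈ y → half x ≈ half y
half-cong {x} {y} x≈y ε 0<ε = let (N , p) = x≈y ε 0<ε in
  N , λ n n≥ → ∣½*-½*∣< (seq x n) (seq y n) 0<ε (p n n≥)

half+half : ∀ x → half x +ℝ half x ≈ x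
half+half x = seq-≡⇒≈ {half x +ℝ half x} {x} (λ n → ½+½ (seq x n))

0≤-half : ∀ {x} → 0ℝ ≤ℝ x → 0ℝ ≤ℝ half x
0≤-half {x} 0≤x ε 0<ε = let (N , p) = 0≤x ε 0<ε in
  N , λ n n≥ → ℚ.<-trans (half-pos (p n n≥))
    (subst (ℚ._< ½ ℚ.* seq x n ℚ.+ ε) (sym (ℚ.*-distribˡ-+ ½ (seq x n) ε))
      (ℚ.+-monoʳ-< (½ ℚ.* seq x n) (½*-< 0<ε)))

-- Rational, integer and natural numbers inside the reals

0≤-fromℚ : ∀ {q} → 0ℚ ℚ.≤ q → 0ℝ ≤ℝ fromℚ q
0≤-fromℚ {q} 0≤q ε 0<ε = 0 , λ _ _ →
  subst (ℚ._< q ℚ.+ ε) (ℚ.+-identityˡ 0ℚ) (ℚ.+-mono-≤-< 0≤q 0<ε)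

0≤-fromℕ : ∀ k → 0ℝ ≤ℝ fromℕ k
0≤-fromℕ k = 0≤-fromℚ (ℚ.nonNegative⁻¹ (+ k ℚ./ 1) {{ℚ.normalize-nonNeg k 1}})

nonnegative-integer : ∀ z → 0ℝ ≤ℝ fromℤ z → ∃[ k ] z ≡ + k
nonnegative-integer (+ k)    _   = k , refl
nonnegative-integer -[1+ k ] 0≤z =
  -- Taking `ε = k + 1` turns the nonnegativity of `-(k + 1)` into `0 < 0`.
  let (N , p) = 0≤z q (ℚ.positive⁻¹ q {{ℚ.normalize-pos (suc k) 1}}) in
  contradiction (p N ℕ.≤-refl) (ℚ.<-irrefl (sym (ℚ.+-inverseˡ q)))
  where q = + suc k ℚ./ 1

-- Equality of rationals is decidable, and if `p` and `q` differed, `ε = ∣ p - q ∣` would give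
-- `∣ p - q ∣ < ∣ p - q ∣`.
fromℚ-injective : ∀ {p q} → fromℚ p ≈ fromℚ q → p ≡ q
fromℚ-injective {p} {q} p≈q with p ℚ.≟ q
... | yes p≡q = p≡q
... | no  p≢q =
  let (N , close) = p≈q ∣ p ℚ.- q ∣ 0<∣p-q∣ in
  contradiction (close N ℕ.≤-refl) (ℚ.<-irrefl refl)
  where
  p-q≡0⇒p≡q : p ℚ.- q ≡ 0ℚ → p ≡ q
  p-q≡0⇒p≡q e = trans (solve 2 (λ p q → p := (p :- q) :+ q) refl p q)
    (trans (cong (ℚ._+ q) e) (ℚ.+-identityˡ q))
    where open +-*-Solver

  0<∣p-q∣ : 0ℚ ℚ.< ∣ p ℚ.- q ∣
  0<∣p-q∣ with ℚ.<-cmp 0ℚ ∣ p ℚ.- q ∣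
  ... | tri< lt _ _ = lt
  ... | tri≈ _ eq _ = contradiction (p-q≡0⇒p≡q (ℚ.∣p∣≡0⇒p≡0 _ (sym eq))) p≢q
  ... | tri> _ _ gt = contradiction (ℚ.<-≤-trans gt (ℚ.0≤∣p∣ (p ℚ.- q))) (ℚ.<-irrefl refl)

-- With the quotient in explicit lowest terms its numerator can be read off, and addition reduces to
-- integer arithmetic.
/1-mkℚ : ∀ k → + k ℚ./ 1 ≡ mkℚ (+ k) 0 (coprime-sym (1-coprimeTo k))
/1-mkℚ k = ℚ.normalize-coprime (coprime-sym (1-coprimeTo k))

fromℕ-injective : ∀ {a b} → fromℕ a ≈ fromℕ b → a ≡ b
fromℕ-injective {a} {b} a≈b = ℤ.+-injective (cong ℚ.numerator
  (trans (sym (/1-mkℚ a)) (trans (fromℚ-injective a≈b) (/1-mkℚ b))))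

/1-+ : ∀ a b → + (a ℕ.+ b) ℚ./ 1 ≡ (+ a ℚ./ 1) ℚ.+ (+ b ℚ./ 1)
/1-+ a b rewrite /1-mkℚ a | /1-mkℚ b =
  sym (cong (ℚ._/ 1) (cong₂ ℤ._+_ (ℤ.*-identityʳ (+ a)) (ℤ.*-identityʳ (+ b))))

fromℕ-+ : ∀ a b → fromℕ (a ℕ.+ b) ≈ fromℕ a +ℝ fromℕ b
fromℕ-+ a b = seq-≡⇒≈ {fromℕ (a ℕ.+ b)} {fromℕ a +ℝ fromℕ b} (λ _ → /1-+ a b)

sum-fromℕ : ∀ {n} (f : Vector ℕ n) → sum (map fromℕ f) ≈ fromℕ (sumℕ f)
sum-fromℕ {zero}  f = ≈-refl 0ℝ
sum-fromℕ {suc n} f = begin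
  fromℕ (f zero) +ℝ sum (map fromℕ (f ∘ suc))
    ≈⟨ +ℝ-cong {fromℕ (f zero)} {fromℕ (f zero)} {sum (map fromℕ (f ∘ suc))} {fromℕ (sumℕ (f ∘ suc))}
         (≈-refl (fromℕ (f zero))) (sum-fromℕ (f ∘ suc)) ⟩
  fromℕ (f zero) +ℝ fromℕ (sumℕ (f ∘ suc))
    ≈⟨ fromℕ-+ (f zero) (sumℕ (f ∘ suc)) ⟨
  fromℕ (f zero ℕ.+ sumℕ (f ∘ suc)) ∎
  where open ≈-Reasoning

fromℕ-cong : ∀ {a b} → a ≡ b → fromℕ a ≈ fromℕ b
fromℕ-cong {a} refl = ≈-refl (fromℕ a)

palindromic-ℕ : ∀ {n} {R : Vector ℝ n} {r : Vector ℕ n} → R ≋ map fromℕ r → Palindromic R →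
                ∀ i → r i ≡ r (opposite i)
palindromic-ℕ {R = R} {r} R≋r pal i = fromℕ-injective (begin
  fromℕ (r i)            ≈⟨ R≋r i ⟨
  R i                    ≈⟨ pal i ⟩
  R (opposite i)         ≈⟨ R≋r (opposite i) ⟩
  fromℕ (r (opposite i)) ∎)
  where open ≈-Reasoning

-- Matrices fixed by the dihedral group

module _ {n} {A : Matrix n} (symmetric : ℝP.Symmetric A) (reflective : ℝP.Reflective A) where
  open ≈-Reasoning

  -- A quarter turn is a transposition followed by a reflection. Allowing any `B` that agrees with
  -- `A` lets the argument be iterated for the half and three-quarter turns.
  rotate-fixed : ∀ {B : Matrix n} → (∀ i j → B i j ≈ A i j) → ∀ i j → rotate B i j ≈ A i j
  rotate-fixed {B} B≈A i j = begin
    B (opposite j) i ≈⟨ B≈A (opposite j) i ⟩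
    A (opposite j) i ≈⟨ symmetric (opposite j) i ⟩
    A i (opposite j) ≈⟨ reflective i j ⟩
    A i j            ∎

  horizontal-fixed : ∀ i j → A (opposite i) j ≈ A i j
  horizontal-fixed i j = begin
    A (opposite i) j ≈⟨ symmetric (opposite i) j ⟩
    A j (opposite i) ≈⟨ reflective j i ⟩
    A j i            ≈⟨ symmetric j i ⟩
    A i j            ∎

  rotate²-fixed : ∀ i j → rotate (rotate A) i j ≈ A i j
  rotate²-fixed = rotate-fixed {rotate A} (rotate-fixed {A} (λ i j → ≈-refl (A i j)))

  -- Transposition and one reflection generate the group, so invariance under these two is enough.
  D₄-fixed : ∀ g i → act g A i ≋ A i
  D₄-fixed rot0         i j = ≈-refl (A i j)
  D₄-fixed rot90        i j = rotate-fixed {A} (λ i j → ≈-refl (A i j)) i j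
  D₄-fixed rot180       i j = rotate²-fixed i j
  D₄-fixed rot270       i j = rotate-fixed {rotate (rotate A)} rotate²-fixed i j
  D₄-fixed vertical     i j = reflective i j
  D₄-fixed horizontal   i j = horizontal-fixed i j
  D₄-fixed diagonal     i j = symmetric j i
  D₄-fixed antidiagonal i j = begin
    A (opposite j) (opposite i) ≈⟨ reflective (opposite j) i ⟩
    A (opposite j) i            ≈⟨ horizontal-fixed j i ⟩
    A j i                       ≈⟨ symmetric j i ⟩
    A i j                       ∎

  𝒯⁴-intro : ∀ {R S} → R ≋ S → (∀ i j → 0ℝ ≤ℝ A i j) → (∀ i → sum (A i) ≈ R i) → 𝒯⁴ R S A
  𝒯⁴-intro {R} {S} R≋S 0≤A rows = record
    { member = record
      { nonnegative = 0≤A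
      ; rowSums     = rows
      ; columnSums  = λ j → begin
          sum (λ i → A i j) ≈⟨ sumℝ-cong (λ i → symmetric i j) ⟩
          sum (A j)         ≈⟨ rows j ⟩
          R j               ≈⟨ R≋S j ⟩
          S j               ∎
      }
    ; fixed = D₄-fixed
    }

-- Row and column sums of an invariant matrix

module _ {n} {R S : Vector ℝ n} {A : Matrix n} (A∈𝒯⁴ : 𝒯⁴ R S A) where
  open 𝒯⁴ A∈𝒯⁴
  open 𝒯 member
  open ≈-Reasoning

  𝒯⁴-symmetric : ℝP.Symmetric A
  𝒯⁴-symmetric i j = fixed diagonal j i

  𝒯⁴-reflective : ℝP.Reflective A
  𝒯⁴-reflective = fixed vertical

  𝒯⁴-sums-equal : R ≋ S
  𝒯⁴-sums-equal i = begin
    R i               ≈⟨ rowSums i ⟨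
    sum (A i)         ≈⟨ sumℝ-cong (𝒯⁴-symmetric i) ⟩
    sum (λ j → A j i) ≈⟨ columnSums i ⟩
    S i               ∎

  -- Reflection in the horizontal axis exchanges rows `i` and `opposite i`.
  𝒯⁴-palindromic : Palindromic R
  𝒯⁴-palindromic i = begin
    R i                ≈⟨ rowSums i ⟨
    sum (A i)          ≈⟨ sumℝ-cong (fixed horizontal i) ⟨
    sum (A (opposite i)) ≈⟨ rowSums (opposite i) ⟩
    R (opposite i)     ∎

𝒯⁴-inhabited : ∀ {n} {R S : Vector ℝ n} → Nonnegative R → R ≋ S → Palindromic R → ∃ (𝒯⁴ R S)
𝒯⁴-inhabited {n} {R} {S} 0≤R R≋S pal =
  ℝP.cross h , 𝒯⁴-intro (ℝP.cross-symmetric h h-pal) (ℝP.cross-reflective h) R≋S nonneg rows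
  where
  open ≈-Reasoning

  h : Vector ℝ n
  h = map half R

  h-pal : ∀ i → h i ≈ h (opposite i)
  h-pal i = half-cong {R i} {R (opposite i)} (pal i)

  0≤-single : ∀ i j {x} → 0ℝ ≤ℝ x → 0ℝ ≤ℝ ℝP.single {n} i x j
  0≤-single i j 0≤x with i ≟ j
  ... | yes _ = 0≤x
  ... | no  _ = 0≤-fromℚ ℚ.≤-refl

  nonneg : ∀ i j → 0ℝ ≤ℝ ℝP.cross h i j
  nonneg i j = 0≤-+ {ℝP.single i (h i) j} {ℝP.single (opposite i) (h i) j}
    (0≤-single i j (0≤-half {R i} (0≤R i))) (0≤-single (opposite i) j (0≤-half {R i} (0≤R i)))

  rows : ∀ i → sum (ℝP.cross h i) ≈ R i
  rows i = begin
    sum (ℝP.cross h i) ≈⟨ ℝP.cross-row h i ⟩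
    h i +ℝ h i         ≈⟨ half+half (R i) ⟩
    R i                ∎

-- Integral matrices

𝒯⁴ℤ-intro : ∀ {n} {R S : Vector ℝ n} {r : Vector ℕ n} → R ≋ S → R ≋ map fromℕ r →
            (B : Fin n → Fin n → ℕ) → ℕP.Symmetric B → ℕP.Reflective B →
            (∀ i → sumℕ (B i) ≡ r i) → ∃ (𝒯⁴ℤ R S)
𝒯⁴ℤ-intro {n} {R} {S} {r} R≋S R≋r B B-symmetric B-reflective rows = map fromℕ ∘ B , record
  { member   = 𝒯⁴-intro {A = map fromℕ ∘ B}
                 (λ i j → fromℕ-cong (B-symmetric i j)) (λ i j → fromℕ-cong (B-reflective i j))
                 R≋S (λ i j → 0≤-fromℕ (B i j)) rows′
  ; integral = λ i j → + B i j , ≈-refl (fromℕ (B i j))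
  }
  where
  open ≈-Reasoning

  rows′ : ∀ i → sum (map fromℕ (B i)) ≈ R i
  rows′ i = begin
    sum (map fromℕ (B i)) ≈⟨ sum-fromℕ (B i) ⟩
    fromℕ (sumℕ (B i))    ≈⟨ fromℕ-cong (rows i) ⟩
    fromℕ (r i)           ≈⟨ R≋r i ⟨
    R i                   ∎

-- Necessity of the parity condition

module _ {n} {R S : Vector ℝ n} {r : Vector ℕ n} {A : Matrix n}
         (R≋r : R ≋ map fromℕ r) (A∈𝒯⁴ℤ : 𝒯⁴ℤ R S A) where
  open 𝒯⁴ℤ A∈𝒯⁴ℤ
  open 𝒯 (𝒯⁴.member member)

  private
    -- Entries that are integral and nonnegative are natural numbers, so `A` is replaced by a matrix
    -- over `ℕ`, where the parity lemmas apply.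
    natural : ∀ i j → ∃[ k ] A i j ≈ fromℕ k
    natural i j =
      let (z , A≈z) = integral i j
          (k , z≡k) = nonnegative-integer z (0≤-resp-≈ {A i j} {fromℤ z} A≈z (nonnegative i j))
      in k , subst (λ z → A i j ≈ fromℤ z) z≡k A≈z

    B : Fin n → Fin n → ℕ
    B i j = proj₁ (natural i j)

    A≈B : ∀ i j → A i j ≈ fromℕ (B i j)
    A≈B i j = proj₂ (natural i j)

    -- Injectivity of `fromℕ` turns the real symmetries of `A` into propositional equalities for
    -- `B`.
    transfer : ∀ i j k l → A i j ≈ A k l → B i j ≡ B k l
    transfer i j k l eq = fromℕ-injective (begin
      fromℕ (B i j) ≈⟨ A≈B i j ⟨
      A i j         ≈⟨ eq ⟩
      A k l         ≈⟨ A≈B k l ⟩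
      fromℕ (B k l) ∎)
      where open ≈-Reasoning

    B-symmetric : ℕP.Symmetric B
    B-symmetric i j = transfer i j j i (𝒯⁴-symmetric member i j)

    B-reflective : ℕP.Reflective B
    B-reflective i j = transfer i (opposite j) i j (𝒯⁴-reflective member i j)

    B-rows : ∀ i → sumℕ (B i) ≡ r i
    B-rows i = fromℕ-injective (begin
      fromℕ (sumℕ (B i))    ≈⟨ sum-fromℕ (B i) ⟨
      sum (map fromℕ (B i)) ≈⟨ sumℝ-cong (A≈B i) ⟨
      sum (A i)             ≈⟨ rowSums i ⟩
      R i                   ≈⟨ R≋r i ⟩
      fromℕ (r i)           ∎)
      where open ≈-Reasoning

  𝒯⁴ℤ-parity : ParityCondition r
  𝒯⁴ℤ-parity = even , odd
    where
    even : 2 ∣ n → ∀ i → 2 ∣ r i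
    even 2∣n i = subst (2 ∣_) (B-rows i) (palindromic-sum-even (B i) (B-reflective i) 2∣n)

    odd : ¬ 2 ∣ n → ∀ (m : Fin n) → suc (toℕ m) ≡ ⌈ n /2⌉ → oddCount r ℕ.≤ r m
    odd ¬2∣n m mid = begin
      oddCount r                  ≡⟨ oddCount-sum r ⟩
      sumℕ (λ i → r i % 2)        ≤⟨ sumℕ-mono-≤ row-parity ⟩
      sumℕ (B m)                  ≡⟨ B-rows m ⟩
      r m                         ∎
      where
      open ℕ.≤-Reasoning
      -- Row `i` is palindromic, so `r i` has the parity of its middle entry `B i m`. By symmetry
      -- this entry lies in row `m`, and it is at least its own remainder modulo 2.
      row-parity : ∀ i → r i % 2 ℕ.≤ B m i
      row-parity i = subst₂ ℕ._≤_
        (trans (sym (palindromic-sum-parity (B i) (B-reflective i) m (ceil⇒middle ¬2∣n m mid)))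
               (cong (_% 2) (B-rows i)))
        (B-symmetric i m) (m%n≤m (B i m) 2)

-- The integral matrix for odd order

module _ {n} (r : Vector ℕ n) (m : Fin n) (mid : opposite m ≡ m)
         (pal : ∀ i → r i ≡ r (opposite i)) (enough : oddCount r ℕ.≤ r m) where

  private
    -- The middle component is set to zero first, so that the diagonals put nothing on the centre
    -- and `parity m` vanishes; `rest` then accounts for row `m`.
    off halfOff parity : Vector ℕ n
    off i     = if does (m ≟ i) then 0 else r i
    halfOff i = off i / 2
    parity i  = off i % 2

    rest : ℕ
    rest = r m ℕ.∸ sumℕ parity

    off-pal : ∀ i → off i ≡ off (opposite i)
    off-pal i with m ≟ i | m ≟ opposite i
    ... | yes _ | yes _ = refl
    ... | no _  | no _  = pal i
    ... | yes p | no ¬q = contradiction (trans (sym mid) (cong opposite p)) ¬q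
    ... | no ¬p | yes q = contradiction (trans (sym mid) (ℕP.opposite-≡˘ q)) ¬p

    -- This guarantees that the subtraction in `rest` is not truncated. Dropping the middle parity
    -- can only lower the sum below `oddCount r`.
    parity-sum≤ : sumℕ parity ℕ.≤ r m
    parity-sum≤ = ℕ.≤-trans (sumℕ-mono-≤ below)
                            (subst (ℕ._≤ r m) (oddCount-sum r) enough)
      where
      below : ∀ i → parity i ℕ.≤ r i % 2
      below i with m ≟ i
      ... | yes _ = z≤n
      ... | no  _ = ℕ.≤-refl

    off+single : ∀ i → off i ℕ.+ single m (r m) i ≡ r i
    off+single i with m ≟ i
    ... | yes refl = refl
    ... | no  _    = ℕ.+-identityʳ (r i)

  oddMatrix : Fin n → Fin n → ℕ
  oddMatrix i j = cross halfOff i j ℕ.+ hub m parity rest i j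

  oddMatrix-symmetric : ℕP.Symmetric oddMatrix
  oddMatrix-symmetric i j = cong₂ ℕ._+_
    (ℕP.cross-symmetric halfOff (λ i → cong (_/ 2) (off-pal i)) i j)
    (ℕP.hub-symmetric m parity rest i j)

  oddMatrix-reflective : ℕP.Reflective oddMatrix
  oddMatrix-reflective i j = cong₂ ℕ._+_
    (ℕP.cross-reflective halfOff i j)
    (ℕP.hub-reflective m parity rest mid (λ i → cong (_% 2) (off-pal i)) i j)

  -- Away from `m`, two halves and a remainder make up `r i`. In row `m` those terms are zero, and
  -- the parities together with `rest` make up `r m`.
  oddMatrix-row : ∀ i → sumℕ (oddMatrix i) ≡ r i
  oddMatrix-row i = begin
    sumℕ (oddMatrix i)
      ≡⟨ ∑-distrib-+ (cross halfOff i) (hub m parity rest i) ⟩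
    sumℕ (cross halfOff i) ℕ.+ sumℕ (hub m parity rest i)
      ≡⟨ cong₂ ℕ._+_ (ℕP.cross-row halfOff i) (ℕP.hub-row m parity rest i) ⟩
    (halfOff i ℕ.+ halfOff i) ℕ.+ (parity i ℕ.+ single m (sumℕ parity ℕ.+ rest) i)
      ≡⟨ ℕ.+-assoc (halfOff i ℕ.+ halfOff i) (parity i) _ ⟨
    ((halfOff i ℕ.+ halfOff i) ℕ.+ parity i) ℕ.+ single m (sumℕ parity ℕ.+ rest) i
      ≡⟨ cong₂ ℕ._+_ (halves+parity (off i)) (cong (λ x → single m x i) (ℕ.m+[n∸m]≡n parity-sum≤)) ⟩
    off i ℕ.+ single m (r m) i
      ≡⟨ off+single i ⟩
    r i ∎
    where open ≡-Reasoning

𝒯⁴ℤ-inhabited : ∀ {n} {R S : Vector ℝ n} {r : Vector ℕ n} → R ≋ map fromℕ r → R ≋ S →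
                Palindromic R → ParityCondition r → ∃ (𝒯⁴ℤ R S)
𝒯⁴ℤ-inhabited {n} {R} {S} {r} R≋r R≋S pal (even , odd) with 2 ∣? n
-- Every `r i` is even, so halving is exact and the two-diagonal matrix already works over `ℕ`.
... | yes 2∣n = 𝒯⁴ℤ-intro {S = S} R≋S R≋r (cross h)
    (ℕP.cross-symmetric h (λ i → cong (_/ 2) (r-pal i))) (ℕP.cross-reflective h)
    (λ i → trans (ℕP.cross-row h i) (halves (even 2∣n i)))
  where
  h : Vector ℕ n
  h i = r i / 2

  r-pal : ∀ i → r i ≡ r (opposite i)
  r-pal = palindromic-ℕ {R = R} {r} R≋r pal
... | no ¬2∣n = let (m , mid) = middle ¬2∣n
                    fix = middle⇒fixed m mid
                    r-pal = palindromic-ℕ {R = R} {r} R≋r pal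
                    -- With `n = 2m + 1` the ceiling is `m + 1`, the one-based position of `m`.
                    enough = odd ¬2∣n m (sym (trans (cong ⌈_/2⌉ mid) (⌈/2⌉-middle (toℕ m))))
  in 𝒯⁴ℤ-intro {S = S} R≋S R≋r (oddMatrix r m fix r-pal enough)
       (oddMatrix-symmetric r m fix r-pal enough) (oddMatrix-reflective r m fix r-pal enough)
       (oddMatrix-row r m fix r-pal enough)

theorem18 : (n : ℕ) → n ≥ 1 →
    ( (R S : Vector ℝ n) → Nonnegative R → Nonnegative S → sum R ≈ sum S →
    ∃ (𝒯⁴ R S) ⇔ ((R ≋ S) × Palindromic R) )
    × ( (R S : Vector ℝ n) → Nonnegative R → Nonnegative S → sum R ≈ sum S →
    (r s : Vector ℕ n) → R ≋ map fromℕ r → S ≋ map fromℕ s →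
    ∃ (𝒯⁴ℤ R S) ⇔ ((R ≋ S) × Palindromic R × ParityCondition r) )
theorem18 n _ =
    (λ R S 0≤R _ _ → mk⇔
      (λ (A , A∈) → 𝒯⁴-sums-equal A∈ , 𝒯⁴-palindromic A∈)
      (λ (R≋S , pal) → 𝒯⁴-inhabited {S = S} 0≤R R≋S pal))
  , (λ R S _ _ _ r _ R≋r _ → mk⇔
      (λ (A , A∈) → let A∈𝒯⁴ = 𝒯⁴ℤ.member A∈ in
        𝒯⁴-sums-equal A∈𝒯⁴ , 𝒯⁴-palindromic A∈𝒯⁴ , 𝒯⁴ℤ-parity {r = r} R≋r A∈)
      (λ (R≋S , pal , parity) → 𝒯⁴ℤ-inhabited {S = S} {r = r} R≋r R≋S pal parity))
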